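{- Let $G$ be a simple graph on $n$ vertices with degree sequence $\Delta=d_{1}\geq d_{2}\geq \cdots \geq d_{n}=\delta$, where $\Delta\geq 2$. Define $s:=d_1+\cdots+d_{\Delta}-\Delta$. Then: (i) $dis_{\ell}[G] \leq s+1 \leq \Delta^2-\Delta+1$. (ii) $dis_{\ell}[G]\leq m$, where $m$ is the number of edges of $G$. (iii) If there are exactly $t$ vertices of degree $\Delta$ in $G$, then $dis_{\ell}[G] \leq \min\{\Delta^{2}-2\Delta +t +1,\ \Delta^2-\Delta+1\}$. (iv) If there is a unique vertex of degree $\Delta$ in $G$, then $dis_{\ell}[G] \leq \Delta^2-3\Delta+4$. (v) If $G$ is a strongly regular graph with parameters $(n,k,\lambda,\mu)$, then $dis_{\ell}[G] \leq k(k-\lambda-1) +1$. (vi) $dis_{\ell}[G] \leq \left(\dfrac{n-1}{2}\right)^{2}+1$.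
   Context: All graphs are finite, undirected, without loops or multiple edges. Natural numbers are positive integers. $\Delta$ and $\delta$ denote the maximum and minimum degree of $G$. For a vertex $v$ of a graph $G$, $N[v]$ denotes the closed neighborhood of $v$ (i.e. $v$ together with its neighbors). A labeling $f$ of $V(G)$ by numbers is closed distinguishing if for any two adjacent vertices $u,v$ with $N[u]\neq N[v]$ we have $\sum_{w\in N[u]} f(w)\neq \sum_{w\in N[v]} f(w)$. The graph $G$ is closed distinguishing $k$-choosable if for every assignment of lists $L(v)$ of $k$ natural numbers to the vertices $v$ of $G$, there is a closed distinguishing labeling $f$ of $G$ with $f(v)\in L(v)$ for each $v\in V(G)$. The closed distinguishing choice number $dis_{\ell}[G]$ is the minimum natural number $k$ such that $G$ is closed distinguishing $k$-choosable. A $k$-regular graph on $n$ vertices is strongly regular with parameters $(n,k,\lambda,\mu)$ if every two adjacent vertices have exactly $\lambda$ common neighbors and every two distinct non-adjacent vertices have exactly $\mu$ common neighbors. -}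

module Defs where

open import Data.Fin using (Fin)
open import Data.Fin.Properties using (_<?_)
open import Data.Fin.Subset using (Subset; ⁅_⁆; _∪_; _∩_; ∣_∣)
open import Data.Fin.Subset.Properties using (_∈?_)
open import Data.Integer as ℤ using (ℤ; +_)
open import Data.List using (List; length; map; filter; allFin; cartesianProduct)
open import Data.List.Extrema.Nat using (max)
open import Data.List.Membership.Propositional using (_∈_)
open import Data.List.Relation.Binary.Permutation.Propositional using (_↭_)
open import Data.List.Relation.Unary.All using (All)
open import Data.List.Relation.Unary.Linked using (Linked)
open import Data.List.Relation.Unary.Unique.Propositional using (Unique)
open import Data.Nat using (ℕ; _≤_; _≥_; _≟_)
open import Data.Nat.ListAction using (sum)
open import Data.Product using (_×_; _,_; ∃-syntax)
open import Data.Rational.Unnormalised as ℚᵘ using (ℚᵘ)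
open import Data.Vec using (tabulate)
open import Level using (0ℓ)
open import Relation.Binary.Core using (Rel)
open import Relation.Binary.Definitions using (Decidable; Irreflexive; Symmetric)
open import Relation.Binary.PropositionalEquality using (_≡_; _≢_)
open import Relation.Nullary using (¬_)
open import Relation.Nullary.Decidable using (⌊_⌋; _×-dec_)

record Graph (n : ℕ) : Set₁ where
  field
    Adj    : Rel (Fin n) 0ℓ
    adj?   : Decidable Adj
    sym    : Symmetric Adj
    irrefl : Irreflexive _≡_ Adj

module _ {n : ℕ} (G : Graph n) where
  open Graph G

  N⟨_⟩ : Fin n → Subset n
  N⟨ v ⟩ = tabulate (λ w → ⌊ adj? v w ⌋)

  N[_] : Fin n → Subset n
  N[ v ] = ⁅ v ⁆ ∪ N⟨ v ⟩

  degree : Fin n → ℕ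
  degree v = ∣ N⟨ v ⟩ ∣

  degrees : List ℕ
  degrees = map degree (allFin n)

  maxDegree : ℕ
  maxDegree = max 0 degrees

  IsDegreeSequence : List ℕ → Set
  IsDegreeSequence ds = Linked _≥_ ds × ds ↭ degrees

  -- Each edge is listed once, as the pair (u , v) with u < v.
  edges : List (Fin n × Fin n)
  edges = filter (λ (u , v) → (u <? v) ×-dec adj? u v)
                 (cartesianProduct (allFin n) (allFin n))

  edgeCount : ℕ
  edgeCount = length edges

  #ofDegree : ℕ → ℕ
  #ofDegree d = length (filter (λ v → degree v ≟ d) (allFin n))

  closedSum : (Fin n → ℕ) → Fin n → ℕ
  closedSum f v = sum (map f (filter (_∈? N[ v ]) (allFin n)))

  ClosedDistinguishing : (Fin n → ℕ) → Set
  ClosedDistinguishing f =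
    ∀ u v → Adj u v → N[ u ] ≢ N[ v ] → closedSum f u ≢ closedSum f v

  -- A list of k natural numbers is a set of k distinct positive integers.
  IsListAssignment : ℕ → (Fin n → List ℕ) → Set
  IsListAssignment k L = ∀ v → length (L v) ≡ k × Unique (L v) × All (1 ≤_) (L v)

  ClosedDistinguishingChoosable : ℕ → Set
  ClosedDistinguishingChoosable k =
    ∀ (L : Fin n → List ℕ) → IsListAssignment k L →
    ∃[ f ] ((∀ v → f v ∈ L v) × ClosedDistinguishing f)

  -- k is the closed distinguishing choice number dis_ℓ[G].
  IsDisℓ : ℕ → Set
  IsDisℓ k = 1 ≤ k × ClosedDistinguishingChoosable k ×
             (∀ j → 1 ≤ j → ClosedDistinguishingChoosable j → k ≤ j)

  StronglyRegular : (k lam mu : ℕ) → Set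
  StronglyRegular k lam mu =
    (∀ v → degree v ≡ k) ×
    (∀ u v → Adj u v → ∣ N⟨ u ⟩ ∩ N⟨ v ⟩ ∣ ≡ lam) ×
    (∀ u v → u ≢ v → ¬ Adj u v → ∣ N⟨ u ⟩ ∩ N⟨ v ⟩ ∣ ≡ mu)

fromℤ : ℤ → ℚᵘ
fromℤ i = i ℚᵘ./ 1

-- The inequality dis_ℓ[G] ≤ B.  Constructively a least choosable number need
-- not be computable from a choosable one, so its existence is doubly negated;
-- the second component adds the constructive content, namely that some
-- positive integer k ≤ B has the property being minimised.  The two components
-- are classically equivalent, and the first also gives d ≤ B for every d with
-- IsDisℓ G d, since the order on ℚᵘ is decidable.
disℓ[_]≤_ : ∀ {n} → Graph n → ℚᵘ → Set
disℓ[ G ]≤ B =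
  ¬ ¬ (∃[ d ] (IsDisℓ G d × fromℤ (+ d) ℚᵘ.≤ B)) ×
  (∃[ k ] (1 ≤ k × fromℤ (+ k) ℚᵘ.≤ B × ClosedDistinguishingChoosable G k))

infix 4 disℓ[_]≤_

-- The labeling is chosen greedily. An edge uv with N[u] ≠ N[v] is settled by the
-- last labeled vertex w of N[u] Δ N[v]; the edge then rules out a single label of
-- w, and, up to swapping u and v, it satisfies u ∈ N(w) and v ∉ N[w]. Lists longer
-- than the number of such edges at w therefore suffice, and every bound of the
-- theorem estimates that number. The first labeled vertex is under no constraint,
-- as labels are positive; taking it to be the unique vertex of degree Δ gives (iv).
module Submission where

open import Defs
open import Data.Bool using (true; false; if_then_else_)
open import Data.Fin as Fin using (Fin; zero; suc)
import Data.Fin.Properties as Finₚ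
open import Data.Fin.Subset as Subset using (Subset; ∣_∣)
open import Data.Fin.Subset.Properties using (_∈?_)
open import Data.List as List using (List; []; _∷_; _++_; length; map; filter; allFin)
open import Data.List.Extrema.Nat using (xs≤max; argmax-sel)
open import Data.List.Membership.Propositional using (_∈_; _∉_; find; lose)
open import Data.List.Membership.Propositional.Properties
open import Data.List.Properties using (map-∘; length-map; length-++; length-take; filter-≐; filter-accept; filter-reject)
open import Data.List.Relation.Binary.Permutation.Propositional using (↭-sym)
open import Data.List.Relation.Binary.Permutation.Propositional.Properties as Perm using (shift; ∈-resp-↭; All-resp-↭)
open import Data.List.Relation.Unary.All as All using (All; []; _∷_)
open import Data.List.Relation.Unary.All.Properties using (¬Any⇒All¬; take⁺)
open import Data.List.Relation.Unary.AllPairs using (AllPairs; []; _∷_)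
open import Data.List.Relation.Unary.Any using (here; there; any?)
open import Data.List.Relation.Unary.Unique.Propositional using (Unique)
open import Data.List.Relation.Unary.Linked.Properties using (Linked⇒AllPairs)
import Data.List.Relation.Unary.Unique.Propositional.Properties as Unique
open import Data.Nat as ℕ using (ℕ)
open import Data.Nat.Induction using (<-rec)
open import Data.Nat.ListAction using (sum)
open import Data.Nat.ListAction.Properties using (sum-↭)
open import Data.Product using (_×_; _,_; ∃-syntax; ∃!; proj₁; proj₂)
open import Data.Sum using (inj₁; inj₂)
open import Data.Vec using ([]; _∷_)
open import Data.Vec.Functional using (updateAt)
open import Function using (_∘_; id; const)
open import Relation.Binary.Definitions using (tri<; tri≈; tri>)
open import Relation.Binary.PropositionalEquality
open import Relation.Nullary
open import Relation.Nullary.Decidable using (dec-true; dec-false; isYes≗does; decidable-stable; ⌊_⌋; _×-dec_)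
open import Relation.Unary using (Pred; Decidable)

-- A neighbour `u` of `w` carries at most `degree G u` - 1 of these edges, so (i) asks to compare
-- the degrees over N(w) with the Δ largest degrees. Pairing neighbours with positions in the sorted
-- sequence is avoided by a threshold τ ≥ 1: d - 1 ≤ (τ - 1) + (d ∸ τ). Summed over N(w), the first
-- term gives at most Δ(τ - 1), and the second at most the sum of d ∸ τ over all vertices. If τ is
-- the (Δ+1)-st largest degree, the total is exactly s: the Δ largest entries are at least τ and the
-- others have no excess. This τ is positive, because a vertex of degree Δ and its neighbours are
-- Δ+1 vertices of positive degree. With τ = Δ - 1, only vertices of degree Δ have an excess, namely
-- 1 each, which yields (iii) and (iv).

module _ {a} {A : Set a} where
  open import Data.Nat using (_+_; _*_; _∸_; _≤_; z≤n; s≤s⁻¹)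
  open import Data.Nat.Properties
  open import Algebra.Properties.CommutativeSemigroup +-commutativeSemigroup using (interchange; x∙yz≈y∙xz)

  -- Sums and counting over lists

  -- The constants keep subtraction out of the estimate: a termwise bound g ≤ h + b - a is summed
  -- with `a` and `b` each on the side where it is added.
  sum-map-≤ : ∀ {g h : A → ℕ} a b xs → (∀ {x} → x ∈ xs → a + g x ≤ b + h x) →
              length xs * a + sum (map g xs) ≤ length xs * b + sum (map h xs)
  sum-map-≤ a b [] _ = z≤n
  sum-map-≤ {g} {h} a b (x ∷ xs) le = begin
    a + length xs * a + (g x + sum (map g xs))   ≡⟨ interchange a _ _ _ ⟩
    a + g x + (length xs * a + sum (map g xs))   ≤⟨ +-mono-≤ (le (here refl)) (sum-map-≤ a b xs (le ∘ there)) ⟩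
    b + h x + (length xs * b + sum (map h xs))   ≡⟨ interchange b _ _ _ ⟩
    b + length xs * b + (h x + sum (map h xs))   ∎
    where open ≤-Reasoning

  sum-map-const : ∀ c (xs : List A) → sum (map (const c) xs) ≡ length xs * c
  sum-map-const c []       = refl
  sum-map-const c (x ∷ xs) = cong (c +_) (sum-map-const c xs)

  sum-map-⊆ : ∀ (g : A → ℕ) {xs ys} → Unique xs → (∀ {x} → x ∈ xs → x ∈ ys) →
              sum (map g xs) ≤ sum (map g ys)
  sum-map-⊆ g {[]}     _          _  = z≤n
  sum-map-⊆ g {x ∷ xs} (x∉ ∷ uniq) xs⊆ys with as , bs , refl ← ∈-∃++ (xs⊆ys (here refl)) =
    ≤-trans (+-monoʳ-≤ (g x) (sum-map-⊆ g uniq xs⊆rest))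
            (≤-reflexive (sym (sum-↭ (Perm.map⁺ g (shift x as bs)))))
    where
      xs⊆rest : ∀ {z} → z ∈ xs → z ∈ as ++ bs
      xs⊆rest z∈xs with ∈-resp-↭ (shift x as bs) (xs⊆ys (there z∈xs))
      ... | here refl = contradiction refl (All.lookup x∉ z∈xs)
      ... | there z∈  = z∈

  length-⊆ : ∀ {xs ys : List A} → Unique xs → (∀ {x} → x ∈ xs → x ∈ ys) → length xs ≤ length ys
  length-⊆ {xs} {ys} uniq xs⊆ys =
    subst₂ _≤_ (sum-ones xs) (sum-ones ys) (sum-map-⊆ (const 1) uniq xs⊆ys)
    where
      sum-ones : ∀ (zs : List A) → sum (map (const 1) zs) ≡ length zs
      sum-ones zs = trans (sum-map-const 1 zs) (*-identityʳ (length zs))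

  sum-map-agree : ∀ {f g : A → ℕ} {xs} → (∀ {x} → x ∈ xs → f x ≡ g x) → sum (map f xs) ≡ sum (map g xs)
  sum-map-agree {xs = []}     _  = refl
  sum-map-agree {xs = x ∷ xs} eq = cong₂ _+_ (eq (here refl)) (sum-map-agree (eq ∘ there))

  -- The effect of changing one label, written with crossed summands so that no truncated
  -- subtraction enters.
  sum-map-agree-off : ∀ {f g : A → ℕ} {w xs} → (∀ {x} → x ≢ w → f x ≡ g x) → Unique xs → w ∈ xs →
                      g w + sum (map f xs) ≡ f w + sum (map g xs)
  sum-map-agree-off {f} {g} {w} {w ∷ xs} eq (w∉ ∷ _) (here refl)
    rewrite sum-map-agree {f} {g} {xs} (λ x∈ → eq (λ { refl → All.lookup w∉ x∈ refl })) = x∙yz≈y∙xz (g w) (f w) _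
  sum-map-agree-off {f} {g} {w} {x ∷ xs} eq (x∉ ∷ uniq) (there w∈) = begin
    g w + (f x + sum (map f xs)) ≡⟨ x∙yz≈y∙xz (g w) (f x) _ ⟩
    f x + (g w + sum (map f xs)) ≡⟨ cong₂ _+_ (eq (All.lookup x∉ w∈)) (sum-map-agree-off eq uniq w∈) ⟩
    g x + (f w + sum (map g xs)) ≡⟨ x∙yz≈y∙xz (g x) (f w) _ ⟩
    f w + (g x + sum (map g xs)) ∎
    where open ≡-Reasoning

  length-filter-map : ∀ {b p} {B : Set b} {P : Pred A p} (P? : Decidable P) (f : B → A) xs →
                      length (filter P? (map f xs)) ≡ length (filter (P? ∘ f) xs)
  length-filter-map P? f [] = refl
  length-filter-map P? f (x ∷ xs) with does (P? (f x))
  ... | true  = cong ℕ.suc (length-filter-map P? f xs)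
  ... | false = length-filter-map P? f xs

  -- As no value exceeds `suc d`, only the values equal to `suc d` leave something above `d`, and
  -- they leave exactly 1.
  sum-map-∸-≤ : ∀ (g : A → ℕ) d → (∀ x → g x ≤ ℕ.suc d) → ∀ xs →
                sum (map (λ x → g x ∸ d) xs) ≤ length (filter (λ x → g x ℕ.≟ ℕ.suc d) xs)
  sum-map-∸-≤ g d g≤ []       = z≤n
  sum-map-∸-≤ g d g≤ (x ∷ xs) = by-cases (g x ℕ.≟ ℕ.suc d)
    where
      top? : Decidable (λ x → g x ≡ ℕ.suc d)
      top? x = g x ℕ.≟ ℕ.suc d
      by-cases : Dec (g x ≡ ℕ.suc d) → sum (map (λ x → g x ∸ d) (x ∷ xs)) ≤ length (filter top? (x ∷ xs))
      by-cases (yes gx≡) = ≤-trans (+-mono-≤ (≤-reflexive (trans (cong (_∸ d) gx≡) (m+n∸n≡m 1 d))) (sum-map-∸-≤ g d g≤ xs))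
        (≤-reflexive (cong length (sym (filter-accept top? gx≡))))
      by-cases (no gx≢) = ≤-trans (+-mono-≤ (≤-reflexive (m≤n⇒m∸n≡0 (s≤s⁻¹ (≤∧≢⇒< (g≤ x) gx≢)))) (sum-map-∸-≤ g d g≤ xs))
        (≤-reflexive (cong length (sym (filter-reject top? gx≢))))

module _ where
  open import Data.Nat using (_+_; _*_; _∸_; _⊓_; _≤_; _≥_; _<_; z≤n; s≤s; zero; suc)
  open import Data.Nat.Properties

  open import Data.Nat.Tactic.RingSolver using (solve-∀)
  open import Data.List.Membership.DecPropositional ℕ._≟_ using () renaming (_∈?_ to _∈ℕ?_)

  -- Pigeonhole, sums of the largest entries, and arithmetic

  pigeonhole : ∀ {xs ys : List ℕ} → Unique xs → length ys < length xs → ∃[ x ] (x ∈ xs × x ∉ ys)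
  pigeonhole {xs} {ys} uniq lt with any? (λ x → ¬? (x ∈ℕ? ys)) xs
  ... | yes some = find some
  ... | no none  = contradiction (length-⊆ uniq xs⊆ys) (<⇒≱ lt)
    where
      xs⊆ys : ∀ {x} → x ∈ xs → x ∈ ys
      xs⊆ys x∈ = decidable-stable (_ ∈ℕ? ys) (All.lookup (¬Any⇒All¬ xs none) x∈)

  -- τ is the (k+1)-st largest entry, and 0 when there is none.
  threshold : ∀ {ds} → AllPairs _≥_ ds → ∀ k → ∃[ τ ] (
                sum (map (_∸ τ) ds) + k * τ ≤ sum (List.take k ds) ×
                sum (map (λ d → 1 ⊓ (d ∸ τ)) ds) ≤ k ×
                (∀ {b} → All (_≤ b) ds → τ ≤ b))
  threshold {[]} _ k = 0 , subst₂ _≤_ (sym (*-zeroʳ k)) refl z≤n , z≤n , λ _ → z≤n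
  threshold {d ∷ ds} (d≥ ∷ sorted) zero =
    d , ≤-reflexive (trans (+-identityʳ _) (vanish (_∸ d) (λ le → m≤n⇒m∸n≡0 le))) ,
    ≤-reflexive (vanish (λ e → 1 ⊓ (e ∸ d)) (λ le → cong (1 ⊓_) (m≤n⇒m∸n≡0 le))) ,
    All.head
    where
      vanish : ∀ (g : ℕ → ℕ) → (∀ {e} → e ≤ d → g e ≡ 0) → sum (map g (d ∷ ds)) ≡ 0
      vanish g eq = begin
        sum (map g (d ∷ ds))         ≡⟨ sum-map-agree (λ e∈ → eq (All.lookup (≤-refl ∷ d≥) e∈)) ⟩
        sum (map (const 0) (d ∷ ds)) ≡⟨ sum-map-const 0 (d ∷ ds) ⟩
        length (d ∷ ds) * 0          ≡⟨ *-zeroʳ (length (d ∷ ds)) ⟩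
        0                            ∎
        where open ≡-Reasoning
  -- The third component exists for this case: with `d≥` it gives `τ ≤ d`, so the head contributes
  -- `d ∸ τ + τ`, which is `d` without truncation. As `1 ⊓ (d ∸ τ)` is the indicator of d > τ, the
  -- head raises that count by at most one.
  threshold {d ∷ ds} (d≥ ∷ sorted) (suc k) with τ , le , few , low ← threshold sorted k =
    τ , (begin
      d ∸ τ + S + (τ + k * τ)   ≡⟨ +-assoc (d ∸ τ) S _ ⟩
      d ∸ τ + (S + (τ + k * τ)) ≡⟨ cong (d ∸ τ +_) (trans (cong (S +_) (+-comm τ _)) (sym (+-assoc S _ τ))) ⟩
      d ∸ τ + (S + k * τ + τ)   ≤⟨ +-monoʳ-≤ (d ∸ τ) (+-monoˡ-≤ τ le) ⟩
      d ∸ τ + (T + τ)           ≡⟨ cong (d ∸ τ +_) (+-comm T τ) ⟩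
      d ∸ τ + (τ + T)           ≡⟨ +-assoc (d ∸ τ) τ T ⟨
      d ∸ τ + τ + T             ≡⟨ cong (_+ T) (m∸n+n≡m (low d≥)) ⟩
      d + T                     ∎) ,
    +-mono-≤ (m⊓n≤m 1 _) few ,
    low ∘ All.tail
    where
      open ≤-Reasoning
      S = sum (map (_∸ τ) ds)
      T = sum (List.take k ds)

  -- The gap between the two sides is the square of the difference `k`, measured from the smaller
  -- number to the larger so that it stays in ℕ.
  4ab≤[a+b]² : ∀ a b → 4 * (a * b) ≤ (a + b) * (a + b)
  4ab≤[a+b]² a b with ≤-total a b
  ... | inj₁ a≤b with k , refl ← m≤n⇒∃[o]m+o≡n a≤b =
    ≤-trans (m≤m+n _ (k * k)) (≤-reflexive (expand a k))
    where
      expand : ∀ a k → 4 * (a * (a + k)) + k * k ≡ (a + (a + k)) * (a + (a + k))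
      expand = solve-∀
  ... | inj₂ b≤a with k , refl ← m≤n⇒∃[o]m+o≡n b≤a =
    ≤-trans (m≤m+n _ (k * k)) (≤-reflexive (expand b k))
    where
      expand : ∀ b k → 4 * ((b + k) * b) + k * k ≡ (b + k + b) * (b + k + b)
      expand = solve-∀

  sum≤length*bound : ∀ {b xs} → All (_≤ b) xs → sum xs ≤ length xs * b
  sum≤length*bound []         = z≤n
  sum≤length*bound (le ∷ les) = +-mono-≤ le (sum≤length*bound les)

-- Subsets as lists without repetition

elements : ∀ {n} → Subset n → List (Fin n)
elements p = filter (_∈? p) (allFin _)

module _ {n : ℕ} {p : Subset n} where
  ∈-elements⁺ : ∀ {x} → x Subset.∈ p → x ∈ elements p
  ∈-elements⁺ = ∈-filter⁺ (_∈? p) (∈-allFin _)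

  ∈-elements⁻ : ∀ {x} → x ∈ elements p → x Subset.∈ p
  ∈-elements⁻ = proj₂ ∘ ∈-filter⁻ (_∈? p) {xs = allFin n}

  elements-unique : Unique (elements p)
  elements-unique = Unique.filter⁺ (_∈? p) (Unique.allFin⁺ n)

length-elements : ∀ {n} (p : Subset n) → length (elements p) ≡ ∣ p ∣
length-elements []      = refl
length-elements (s ∷ p) = by-head s
  where
    open import Data.List.Properties using (map-tabulate)
    open import Data.Fin.Subset.Properties using (drop-there)
    import Data.Vec as Vec
    tail : ∀ s → length (filter (_∈? (s ∷ p)) (List.tabulate suc)) ≡ ∣ p ∣
    tail s = begin
      length (filter (_∈? (s ∷ p)) (List.tabulate suc))      ≡⟨ cong (length ∘ filter (_∈? (s ∷ p))) (map-tabulate id suc) ⟨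
      length (filter (_∈? (s ∷ p)) (map suc (allFin _)))     ≡⟨ length-filter-map (_∈? (s ∷ p)) suc (allFin _) ⟩
      length (filter (λ i → suc i ∈? (s ∷ p)) (allFin _))    ≡⟨ cong length (filter-≐ _ (_∈? p) (drop-there , Vec.there) (allFin _)) ⟩
      length (elements p)                                    ≡⟨ length-elements p ⟩
      ∣ p ∣                                                  ∎
      where open ≡-Reasoning
    by-head : ∀ s → length (elements (s ∷ p)) ≡ ∣ s ∷ p ∣
    by-head true  = cong ℕ.suc (tail true)
    by-head false = tail false

module _ {n : ℕ} (G : Graph n) where
  open Graph G renaming (sym to Adj-sym)
  open import Data.Fin.Subset using (_∩_; ∁; ⁅_⁆)
  open import Data.Fin.Subset.Properties
  open import Data.Nat using (suc; _+_; _*_; _∸_; _⊓_; _≤_; _<_; z≤n; s≤s; s≤s⁻¹)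
  open import Data.Nat.Properties
  import Data.Vec.Properties as Vecₚ

  -- Closed neighbourhoods, conflicting edges and closed sums

  ∈N⟨⟩⁺ : ∀ {v w} → Adj v w → w Subset.∈ N⟨ G ⟩ v
  ∈N⟨⟩⁺ {v} {w} vw = Vecₚ.lookup⇒[]= w _ (trans (Vecₚ.lookup∘tabulate _ w) (trans (isYes≗does (adj? v w)) (dec-true (adj? v w) vw)))

  ∈N⟨⟩⁻ : ∀ {v w} → w Subset.∈ N⟨ G ⟩ v → Adj v w
  ∈N⟨⟩⁻ {v} {w} w∈ with adj? v w in eq
  ... | yes vw = vw
  ... | no _   with () ← trans (sym (cong ⌊_⌋ eq)) (trans (sym (Vecₚ.lookup∘tabulate _ w)) (Vecₚ.[]=⇒lookup w∈))

  self∈N[] : ∀ {v} → v Subset.∈ N[ G ] v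
  self∈N[] {v} = x∈p∪q⁺ (inj₁ (x∈⁅x⁆ v))

  adj∈N[] : ∀ {v w} → Adj v w → w Subset.∈ N[ G ] v
  adj∈N[] vw = x∈p∪q⁺ (inj₂ (∈N⟨⟩⁺ vw))

  ∈N[]-sym : ∀ {v w} → w Subset.∈ N[ G ] v → v Subset.∈ N[ G ] w
  ∈N[]-sym {v} {w} w∈ with x∈p∪q⁻ ⁅ v ⁆ (N⟨ G ⟩ v) w∈
  ... | inj₁ w∈v rewrite x∈⁅y⁆⇒x≡y v w∈v = self∈N[]
  ... | inj₂ w∈N = adj∈N[] (Adj-sym (∈N⟨⟩⁻ w∈N))

  ∈N[]⇒Adj : ∀ {v w} → w Subset.∈ N[ G ] v → w ≢ v → Adj v w
  ∈N[]⇒Adj {v} {w} w∈ w≢v with x∈p∪q⁻ ⁅ v ⁆ (N⟨ G ⟩ v) w∈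
  ... | inj₁ w∈v = contradiction (x∈⁅y⁆⇒x≡y v w∈v) w≢v
  ... | inj₂ w∈N = ∈N⟨⟩⁻ w∈N

  crosses? : ∀ w → Decidable (λ ((u , v) : Fin n × Fin n) → Adj w u × Adj u v × v Subset.∉ N[ G ] w)
  crosses? w (u , v) = adj? w u ×-dec adj? u v ×-dec ¬? (v ∈? N[ G ] w)

  -- The direction of a pair is forced, since `u` is adjacent to `w` and `v` is not; hence no edge
  -- is counted twice.
  crossing : Fin n → List (Fin n × Fin n)
  crossing w = filter (crosses? w) (List.cartesianProduct (allFin n) (allFin n))

  conflicts : Fin n → ℕ
  conflicts w = length (crossing w)

  ∈-crossing⁺ : ∀ {w u v} → Adj w u → Adj u v → v Subset.∉ N[ G ] w → (u , v) ∈ crossing w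
  ∈-crossing⁺ {w} wu uv v∉ =
    ∈-filter⁺ (crosses? w) (∈-cartesianProduct⁺ (∈-allFin _) (∈-allFin _)) (wu , uv , v∉)

  ∈-crossing⁻ : ∀ {w u v} → (u , v) ∈ crossing w → Adj w u × Adj u v × v Subset.∉ N[ G ] w
  ∈-crossing⁻ {w} = proj₂ ∘ ∈-filter⁻ (crosses? w) {xs = List.cartesianProduct (allFin n) (allFin n)}

  crossing-unique : ∀ {w} → Unique (crossing w)
  crossing-unique {w} =
    Unique.filter⁺ (crosses? w) (Unique.cartesianProduct⁺ (Unique.allFin⁺ n) (Unique.allFin⁺ n))

  closedSum-∉ : ∀ {f g w} v → (∀ {x} → x ≢ w → f x ≡ g x) → w Subset.∉ N[ G ] v →
                closedSum G f v ≡ closedSum G g v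
  closedSum-∉ {f} {g} v eq w∉ = sum-map-agree {f = f} {g} {elements (N[ G ] v)} λ x∈ → eq λ { refl → w∉ (∈-elements⁻ x∈) }

  closedSum-∈ : ∀ {f g w} v → (∀ {x} → x ≢ w → f x ≡ g x) → w Subset.∈ N[ G ] v →
                g w + closedSum G f v ≡ f w + closedSum G g v
  closedSum-∈ {f} {g} v eq w∈ = sum-map-agree-off {f = f} {g} eq elements-unique (∈-elements⁺ w∈)

  closedSum-const-0 : ∀ v → closedSum G (const 0) v ≡ 0
  closedSum-const-0 v = trans (sum-map-const 0 vs) (*-zeroʳ (length vs))
    where vs = elements (N[ G ] v)

  -- Greedy labelling

  module _ {k : ℕ} {L : Fin n → List ℕ} (isL : IsListAssignment G k L) where

    -- The edges uv whose symmetric difference N[u] Δ N[v] avoids ws are the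
    -- ones that relabelling the vertices of ws cannot affect.
    AgreeOn : List (Fin n) → Fin n → Fin n → Set
    AgreeOn ws u v = ∀ {w} → w ∈ ws →
      (w Subset.∈ N[ G ] u → w Subset.∈ N[ G ] v) × (w Subset.∈ N[ G ] v → w Subset.∈ N[ G ] u)

    DistinguishingOff : List (Fin n) → (Fin n → ℕ) → Set
    DistinguishingOff ws f =
      ∀ u v → Adj u v → N[ G ] u ≢ N[ G ] v → AgreeOn ws u v → closedSum G f u ≢ closedSum G f v

    -- The equation "new sum at `u` = new sum at `v`" solved for the new label of `w`, which
    -- replaces `f w` in the sum at `u` only. Truncation is harmless: when the new sums do agree,
    -- the subtraction is exact.
    forbidden : (Fin n → ℕ) → Fin n → List ℕ
    forbidden f w = map (λ (u , v) → f w + closedSum G f v ∸ closedSum G f u) (crossing w)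

    module _ {f g : Fin n → ℕ} {w : Fin n} (f≡g : ∀ {y} → y ≢ w → f y ≡ g y) (gw∉ : g w ∉ forbidden f w) where
      separated : ∀ {u v} → Adj u v → w Subset.∈ N[ G ] u → w Subset.∉ N[ G ] v →
                  closedSum G g u ≢ closedSum G g v
      separated {u} {v} uv w∈u w∉v eq = gw∉ (subst (_∈ forbidden f w) value (∈-map⁺ _ uv∈))
        where
          open ≡-Reasoning
          uv∈ : (u , v) ∈ crossing w
          -- `w` differs from `u` because `u` lies in N[v] and `w` does not; so `w` is a genuine
          -- neighbour of `u`.
          uv∈ = ∈-crossing⁺ (Adj-sym (∈N[]⇒Adj w∈u λ { refl → w∉v (adj∈N[] (Adj-sym uv)) })) uv (w∉v ∘ ∈N[]-sym)
          value : f w + closedSum G f v ∸ closedSum G f u ≡ g w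
          value = begin
            f w + closedSum G f v ∸ closedSum G f u ≡⟨ cong (λ s → f w + s ∸ closedSum G f u) (trans (closedSum-∉ v f≡g w∉v) (sym eq)) ⟩
            f w + closedSum G g u ∸ closedSum G f u ≡⟨ cong (_∸ closedSum G f u) (closedSum-∈ u f≡g w∈u) ⟨
            g w + closedSum G f u ∸ closedSum G f u ≡⟨ m+n∸n≡m (g w) (closedSum G f u) ⟩
            g w                                     ∎

      -- If `w` lies in both closed neighbourhoods or in neither, the two sums change by the same
      -- amount and the claim for `f` carries over. The edges with `w` on one side only are the new
      -- ones, and `forbidden` was built for them.
      relabel : ∀ {ws} → DistinguishingOff (w ∷ ws) f → DistinguishingOff ws g
      relabel {ws} dist u v uv Nu≢Nv agree = by-cases (w ∈? N[ G ] u) (w ∈? N[ G ] v)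
        where
          agree-w : (w Subset.∈ N[ G ] u → w Subset.∈ N[ G ] v) × (w Subset.∈ N[ G ] v → w Subset.∈ N[ G ] u) →
                    AgreeOn (w ∷ ws) u v
          agree-w at-w (here refl) = at-w
          agree-w at-w (there y∈)  = agree y∈
          by-cases : Dec (w Subset.∈ N[ G ] u) → Dec (w Subset.∈ N[ G ] v) → closedSum G g u ≢ closedSum G g v
          by-cases (yes w∈u) (no w∉v)  = separated uv w∈u w∉v
          by-cases (no w∉u)  (yes w∈v) = separated (Adj-sym uv) w∈v w∉u ∘ sym
          by-cases (no w∉u)  (no w∉v)  eq =
            dist u v uv Nu≢Nv (agree-w ((λ w∈ → contradiction w∈ w∉u) , (λ w∈ → contradiction w∈ w∉v)))
              (trans (closedSum-∉ u f≡g w∉u) (trans eq (sym (closedSum-∉ v f≡g w∉v))))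
          by-cases (yes w∈u) (yes w∈v) eq =
            dist u v uv Nu≢Nv (agree-w (const w∈v , const w∈u)) (+-cancelˡ-≡ (g w) _ _ (begin
              g w + closedSum G f u ≡⟨ closedSum-∈ u f≡g w∈u ⟩
              f w + closedSum G g u ≡⟨ cong (f w +_) eq ⟩
              f w + closedSum G g v ≡⟨ closedSum-∈ v f≡g w∈v ⟨
              g w + closedSum G f v ∎))
            where open ≡-Reasoning

    -- `ws` holds the vertices still to be labelled. Each conflict at `w` excludes at most one
    -- element of `L w`, so a label survives. Once `ws` is empty, `AgreeOn` is vacuous and the
    -- invariant covers every edge.
    extend : ∀ ws {f} → (∀ {w} → w ∈ ws → conflicts w < k) → (∀ {v} → v ∉ ws → f v ∈ L v) →
             DistinguishingOff ws f → ∃[ g ] ((∀ v → g v ∈ L v) × ClosedDistinguishing G g)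
    extend [] {f} _ f∈ dist = f , (λ v → f∈ λ ()) , λ u v uv Nu≢Nv → dist u v uv Nu≢Nv λ ()
    extend (w ∷ ws) {f} few f∈ dist
      with x , x∈ , x∉ ← pigeonhole {ys = forbidden f w} (proj₁ (proj₂ (isL w)))
                           (subst₂ _<_ (sym (length-map _ (crossing w))) (sym (proj₁ (isL w))) (few (here refl)))
      = extend ws (few ∘ there) g∈ (relabel (λ y≢w → sym (updateAt-minimal _ w f y≢w))
                                            (subst (_∉ forbidden f w) (sym (updateAt-updates w f)) x∉) dist)
      where
        open import Data.Vec.Functional.Properties using (updateAt-updates; updateAt-minimal)
        g = updateAt f w (const x)
        g∈ : ∀ {v} → v ∉ ws → g v ∈ L v
        g∈ {v} v∉ with v Fin.≟ w
        ... | yes refl = subst (_∈ L w) (sym (updateAt-updates w f)) x∈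
        ... | no v≢w   = subst (_∈ L v) (sym (updateAt-minimal v w f v≢w))
                           (f∈ λ { (here v≡w) → v≢w v≡w ; (there v∈) → v∉ v∈ })

    -- v₀ may be labelled first and without regard to its conflicts: an edge uv
    -- with N[u] Δ N[v] = {v₀} is distinguished because labels are positive.
    greedy : ∀ v₀ → 1 ≤ k → (∀ w → w ≢ v₀ → conflicts w < k) →
             ∃[ g ] ((∀ v → g v ∈ L v) × ClosedDistinguishing G g)
    greedy v₀ 1≤k few
      with x , x∈ , _ ← pigeonhole {ys = []} (proj₁ (proj₂ (isL v₀))) (subst (1 ≤_) (sym (proj₁ (isL v₀))) 1≤k)
      = extend others (λ w∈ → few _ (proj₂ (∈-filter⁻ ≢v₀? {xs = allFin n} w∈))) f∈ dist
      where
        open import Data.Vec.Functional.Properties using (updateAt-updates; updateAt-minimal)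
        ≢v₀? : Decidable (_≢ v₀)
        ≢v₀? v = ¬? (v Fin.≟ v₀)
        others = filter ≢v₀? (allFin n)
        -- The value 0 marks a vertex as not yet labelled; before `extend` starts, `v₀` alone
        -- contributes to any closed sum.
        f = updateAt (const 0) v₀ (const x)
        f≡0 : ∀ {y} → y ≢ v₀ → f y ≡ 0
        f≡0 = updateAt-minimal _ v₀ (const 0)
        f∈ : ∀ {v} → v ∉ others → f v ∈ L v
        f∈ {v} v∉ with v Fin.≟ v₀
        ... | yes refl = subst (_∈ L v₀) (sym (updateAt-updates v₀ (const 0))) x∈
        ... | no v≢v₀  = contradiction (∈-filter⁺ ≢v₀? (∈-allFin v) v≢v₀) v∉
        isolated : ∀ {u v} → v₀ Subset.∈ N[ G ] u → v₀ Subset.∉ N[ G ] v → closedSum G f u ≢ closedSum G f v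
        isolated {u} {v} v₀∈u v₀∉v eq = n≮0 (subst (1 ≤_) x≡0 (All.lookup (proj₂ (proj₂ (isL v₀))) x∈))
          where
            open ≡-Reasoning
            x≡0 : x ≡ 0
            x≡0 = begin
              x                                ≡⟨ updateAt-updates v₀ (const 0) ⟨
              f v₀                             ≡⟨ +-identityʳ _ ⟨
              f v₀ + 0                         ≡⟨ cong (f v₀ +_) (closedSum-const-0 u) ⟨
              f v₀ + closedSum G (const 0) u   ≡⟨ closedSum-∈ u f≡0 v₀∈u ⟨
              closedSum G f u                  ≡⟨ eq ⟩
              closedSum G f v                  ≡⟨ closedSum-∉ v f≡0 v₀∉v ⟩
              closedSum G (const 0) v          ≡⟨ closedSum-const-0 v ⟩
              0                                ∎
        dist : DistinguishingOff others f
        dist u v uv Nu≢Nv agree = by-cases (v₀ ∈? N[ G ] u) (v₀ ∈? N[ G ] v)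
          where
            agree-everywhere : (v₀ Subset.∈ N[ G ] u → v₀ Subset.∈ N[ G ] v) → (v₀ Subset.∈ N[ G ] v → v₀ Subset.∈ N[ G ] u) →
                               N[ G ] u ≡ N[ G ] v
            agree-everywhere to from = ⊆-antisym
              (λ {y} y∈ → case-v₀ y (λ { refl → to y∈ }) (λ y∈′ → proj₁ (agree y∈′) y∈))
              (λ {y} y∈ → case-v₀ y (λ { refl → from y∈ }) (λ y∈′ → proj₂ (agree y∈′) y∈))
              where
                case-v₀ : ∀ {P : Set} y → (y ≡ v₀ → P) → (y ∈ others → P) → P
                case-v₀ y eq ne with y Fin.≟ v₀
                ... | yes y≡v₀ = eq y≡v₀
                ... | no y≢v₀  = ne (∈-filter⁺ ≢v₀? (∈-allFin y) y≢v₀)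
            by-cases : Dec (v₀ Subset.∈ N[ G ] u) → Dec (v₀ Subset.∈ N[ G ] v) → closedSum G f u ≢ closedSum G f v
            by-cases (yes ∈u) (no ∉v)  = isolated ∈u ∉v
            by-cases (no ∉u)  (yes ∈v) = isolated ∈v ∉u ∘ sym
            by-cases (yes ∈u) (yes ∈v) = contradiction (agree-everywhere (const ∈v) (const ∈u)) Nu≢Nv
            by-cases (no ∉u)  (no ∉v)  =
              contradiction (agree-everywhere (λ z → contradiction z ∉u) (λ z → contradiction z ∉v)) Nu≢Nv

  choosable : ∀ {k} v₀ → 1 ≤ k → (∀ w → w ≢ v₀ → conflicts w < k) → ClosedDistinguishingChoosable G k
  choosable v₀ 1≤k few L isL = greedy isL v₀ 1≤k few

  -- Counting conflicts through the neighbours of a vertex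

  outside : Fin n → Fin n → Subset n
  outside w u = N⟨ G ⟩ u ∩ ∁ (N[ G ] w)

  length-neighbours : ∀ w → length (elements (N⟨ G ⟩ w)) ≡ degree G w
  length-neighbours w = length-elements (N⟨ G ⟩ w)

  conflicts-≤-sum : ∀ w → conflicts w ≤ sum (map (λ u → ∣ outside w u ∣) (elements (N⟨ G ⟩ w)))
  conflicts-≤-sum w = ≤-trans (length-⊆ crossing-unique crossing⊆) (≤-reflexive (length-pairs (elements (N⟨ G ⟩ w))))
    where
      pairs : List (Fin n) → List (Fin n × Fin n)
      pairs = List.concatMap (λ u → map (u ,_) (elements (outside w u)))
      crossing⊆ : ∀ {e} → e ∈ crossing w → e ∈ pairs (elements (N⟨ G ⟩ w))
      crossing⊆ {u , v} e∈ with wu , uv , v∉ ← ∈-crossing⁻ {w} e∈ =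
        ∈-concatMap⁺ _ (lose (∈-elements⁺ (∈N⟨⟩⁺ wu))
          (∈-map⁺ (u ,_) (∈-elements⁺ (x∈p∩q⁺ (∈N⟨⟩⁺ uv , x∉p⇒x∈∁p v∉)))))
      length-pairs : ∀ us → length (pairs us) ≡ sum (map (λ u → ∣ outside w u ∣) us)
      length-pairs []       = refl
      length-pairs (u ∷ us) = trans (length-++ (map (u ,_) (elements (outside w u))))
        (cong₂ _+_ (trans (length-map (u ,_) (elements (outside w u))) (length-elements (outside w u))) (length-pairs us))

  -- Common neighbours of `w` and `u`, neighbours of `u` outside N[w], and `w` itself are disjoint
  -- parts of N(u); `w` makes the inequality strict.
  outside+common<degree : ∀ {w u} → Adj w u → suc (∣ N⟨ G ⟩ w ∩ N⟨ G ⟩ u ∣ + ∣ outside w u ∣) ≤ degree G u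
  outside+common<degree {w} {u} wu =
    subst₂ _≤_
      (cong suc (trans (length-++ common) (cong₂ _+_ (length-elements (N⟨ G ⟩ w ∩ N⟨ G ⟩ u)) (length-elements (outside w u)))))
      (length-neighbours u)
      (length-⊆ {xs = w ∷ common ++ out} (All.tabulate w≢ ∷ Unique.++⁺ elements-unique elements-unique disjoint) ⊆N)
    where
      common = elements (N⟨ G ⟩ w ∩ N⟨ G ⟩ u)
      out    = elements (outside w u)
      ∈common⁻ : ∀ {x} → x ∈ common → x Subset.∈ N⟨ G ⟩ w × x Subset.∈ N⟨ G ⟩ u
      ∈common⁻ = x∈p∩q⁻ _ _ ∘ ∈-elements⁻
      ∈out⁻ : ∀ {x} → x ∈ out → x Subset.∈ N⟨ G ⟩ u × x Subset.∉ N[ G ] w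
      ∈out⁻ x∈ with x∈u , x∈∁ ← x∈p∩q⁻ _ _ (∈-elements⁻ {p = outside w u} x∈) = x∈u , x∈∁p⇒x∉p x∈∁
      disjoint : ∀ {x} → ¬ (x ∈ common × x ∈ out)
      disjoint (x∈c , x∈o) = proj₂ (∈out⁻ x∈o) (adj∈N[] (∈N⟨⟩⁻ (proj₁ (∈common⁻ x∈c))))
      w≢ : ∀ {x} → x ∈ common ++ out → w ≢ x
      w≢ x∈ refl with ∈-++⁻ common x∈
      ... | inj₁ w∈ = irrefl refl (∈N⟨⟩⁻ (proj₁ (∈common⁻ w∈)))
      ... | inj₂ w∈ = proj₂ (∈out⁻ w∈) self∈N[]
      ⊆N : ∀ {x} → x ∈ w ∷ common ++ out → x ∈ elements (N⟨ G ⟩ u)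
      ⊆N (here refl) = ∈-elements⁺ (∈N⟨⟩⁺ (Adj-sym wu))
      ⊆N (there x∈) with ∈-++⁻ common x∈
      ... | inj₁ x∈c = ∈-elements⁺ (proj₂ (∈common⁻ x∈c))
      ... | inj₂ x∈o = ∈-elements⁺ (proj₁ (∈out⁻ x∈o))

  conflicts-≤ : ∀ w a b (h : Fin n → ℕ) → (∀ {u} → Adj w u → a + ∣ outside w u ∣ ≤ b + h u) →
                degree G w * a + conflicts w ≤ degree G w * b + sum (map h (elements (N⟨ G ⟩ w)))
  conflicts-≤ w a b h le = begin
    degree G w * a + conflicts w                                ≤⟨ +-monoʳ-≤ (degree G w * a) (conflicts-≤-sum w) ⟩
    degree G w * a + sum (map (λ u → ∣ outside w u ∣) us)       ≡⟨ cong (λ l → l * a + sum (map (λ u → ∣ outside w u ∣) us)) (length-neighbours w) ⟨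
    length us * a + sum (map (λ u → ∣ outside w u ∣) us)        ≤⟨ sum-map-≤ a b us (λ u∈ → le (∈N⟨⟩⁻ (∈-elements⁻ u∈))) ⟩
    length us * b + sum (map h us)                              ≡⟨ cong (λ l → l * b + sum (map h us)) (length-neighbours w) ⟩
    degree G w * b + sum (map h us)                             ∎
    where
      open ≤-Reasoning
      us = elements (N⟨ G ⟩ w)

  conflicts-≤-uniform : ∀ w a b → (∀ {u} → Adj w u → a + ∣ outside w u ∣ ≤ b) →
                        degree G w * a + conflicts w ≤ degree G w * b
  conflicts-≤-uniform w a b le = begin
    degree G w * a + conflicts w                        ≤⟨ conflicts-≤ w a b (const 0) (λ wu → ≤-trans (le wu) (m≤m+n b 0)) ⟩
    degree G w * b + sum (map (const 0) us)             ≡⟨ cong (degree G w * b +_) (trans (sum-map-const 0 us) (*-zeroʳ (length us))) ⟩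
    degree G w * b + 0                                  ≡⟨ +-identityʳ _ ⟩
    degree G w * b                                      ∎
    where
      open ≤-Reasoning
      us = elements (N⟨ G ⟩ w)

  excess : ℕ → ℕ
  excess τ = sum (map (λ v → degree G v ∸ τ) (allFin n))

  conflicts-≤-excess : ∀ w σ → conflicts w ≤ degree G w * σ + excess (suc σ)
  conflicts-≤-excess w σ = begin
    conflicts w                                            ≡⟨ cong (_+ conflicts w) (*-zeroʳ (degree G w)) ⟨
    degree G w * 0 + conflicts w                           ≤⟨ conflicts-≤ w 0 σ (λ v → degree G v ∸ suc σ) le ⟩
    degree G w * σ + sum (map (λ v → degree G v ∸ suc σ) (elements (N⟨ G ⟩ w)))     ≤⟨ +-monoʳ-≤ (degree G w * σ) (sum-map-⊆ _ (elements-unique {p = N⟨ G ⟩ w}) (λ _ → ∈-allFin _)) ⟩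
    degree G w * σ + excess (suc σ)                        ∎
    where
      open ≤-Reasoning
      le : ∀ {u} → Adj w u → ∣ outside w u ∣ ≤ σ + (degree G u ∸ suc σ)
      le {u} wu = s≤s⁻¹ (begin
        suc ∣ outside w u ∣              ≤⟨ s≤s (m≤n+m _ _) ⟩
        _                                ≤⟨ outside+common<degree wu ⟩
        degree G u                       ≤⟨ m≤n+m∸n (degree G u) (suc σ) ⟩
        suc σ + (degree G u ∸ suc σ)     ∎)

  -- Maximum degree and the degree sequence

  degree-≤ : ∀ v → degree G v ≤ maxDegree G
  degree-≤ v = All.lookup (xs≤max 0 (degrees G)) (∈-map⁺ (degree G) (∈-allFin v))

  maxDegree-attained : 1 ≤ maxDegree G → ∃[ v ] degree G v ≡ maxDegree G
  maxDegree-attained 1≤Δ with argmax-sel id 0 (degrees G)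
  ... | inj₁ Δ≡0 = contradiction (subst (1 ≤_) Δ≡0 1≤Δ) λ ()
  ... | inj₂ Δ∈ with v , _ , eq ← ∈-map⁻ (degree G) Δ∈ = v , sym eq

  neighbour : ∀ v → 1 ≤ degree G v → ∃[ w ] Adj v w
  neighbour v 1≤d with elements (N⟨ G ⟩ v) in eq
  ... | []    = contradiction (subst (1 ≤_) (trans (sym (length-neighbours v)) (cong length eq)) 1≤d) λ ()
  ... | w ∷ _ = w , ∈N⟨⟩⁻ (∈-elements⁻ (subst (w ∈_) (sym eq) (here refl)))

  excess-maxDegree : ∀ {d} → maxDegree G ≡ suc d → excess d ≤ #ofDegree G (maxDegree G)
  excess-maxDegree {d} Δ≡ =
    subst (λ e → excess d ≤ #ofDegree G e) (sym Δ≡)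
      (sum-map-∸-≤ (degree G) d (λ v → subst (degree G v ≤_) Δ≡ (degree-≤ v)) (allFin n))

  -- The threshold here is Δ - 1, that is `suc d`, so the excess only counts vertices of degree Δ.
  conflicts-≤-maxDegree : ∀ w {d} → maxDegree G ≡ 2 + d → conflicts w ≤ degree G w * d + #ofDegree G (maxDegree G)
  conflicts-≤-maxDegree w {d} Δ≡ = ≤-trans (conflicts-≤-excess w d) (+-monoʳ-≤ (degree G w * d) (excess-maxDegree Δ≡))

  #ofDegree-unique : ∀ {d} v → (∀ {w} → degree G w ≡ d → v ≡ w) → #ofDegree G d ≤ 1
  #ofDegree-unique {d} v only = length-⊆ {ys = v ∷ []} (Unique.filter⁺ has? (Unique.allFin⁺ n))
    (λ w∈ → here (sym (only (proj₂ (∈-filter⁻ has? {xs = allFin n} w∈)))))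
    where
      has? : Decidable (λ v → degree G v ≡ d)
      has? v = degree G v ℕ.≟ d

  degree<∣N[]∣ : ∀ v → degree G v < ∣ N[ G ] v ∣
  degree<∣N[]∣ v = p⊂q⇒∣p∣<∣q∣ ((λ w∈ → adj∈N[] (∈N⟨⟩⁻ w∈)) , v , self∈N[] , λ v∈ → irrefl refl (∈N⟨⟩⁻ v∈))

  Adj⇒degree-pos : ∀ {v w} → Adj v w → 1 ≤ degree G v
  Adj⇒degree-pos {v} vw = subst (1 ≤_) (length-neighbours v) (∈-length (∈-elements⁺ (∈N⟨⟩⁺ vw)))

  -- No vertex of N[v] is isolated once `v` has a neighbour, and N[v] has more than `degree G v`
  -- elements. The summand `1 ⊓ degree G w` is the indicator of a non-isolated vertex, in the form
  -- in which `threshold` counts.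
  degree<#nonisolated : ∀ v → 1 ≤ degree G v → degree G v < sum (map (λ w → 1 ⊓ degree G w) (allFin n))
  degree<#nonisolated v 1≤d = begin-strict
    degree G v                                     <⟨ degree<∣N[]∣ v ⟩
    ∣ N[ G ] v ∣                                   ≡⟨ length-elements (N[ G ] v) ⟨
    length ws                                      ≡⟨ *-identityʳ _ ⟨
    length ws * 1                                  ≤⟨ m≤m+n _ _ ⟩
    length ws * 1 + sum (map (const 0) ws)         ≤⟨ sum-map-≤ 1 0 ws (λ w∈ → ⊓-glb ≤-refl (nonisolated (∈-elements⁻ w∈))) ⟩
    length ws * 0 + sum (map h ws)                 ≡⟨ cong (_+ sum (map h ws)) (*-zeroʳ (length ws)) ⟩
    sum (map h ws)                                 ≤⟨ sum-map-⊆ h (elements-unique {p = N[ G ] v}) (λ _ → ∈-allFin _) ⟩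
    sum (map h (allFin n))                         ∎
    where
      open ≤-Reasoning
      ws = elements (N[ G ] v)
      h : Fin n → ℕ
      h w = 1 ⊓ degree G w
      nonisolated : ∀ {w} → w Subset.∈ N[ G ] v → 1 ≤ degree G w
      nonisolated {w} w∈ with w Fin.≟ v
      ... | yes refl = 1≤d
      ... | no w≢v   = Adj⇒degree-pos (Adj-sym (∈N[]⇒Adj w∈ w≢v))

  conflicts-≤-degreeSequence : ∀ {ds} → IsDegreeSequence G ds → 1 ≤ maxDegree G → ∀ w →
                               conflicts w + maxDegree G ≤ sum (List.take (maxDegree G) ds)
  conflicts-≤-degreeSequence {ds} (sorted , ds↭) 1≤Δ w
    with threshold (Linked⇒AllPairs (λ i≥j j≥k → ≤-trans j≥k i≥j) sorted) (maxDegree G)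
  -- A threshold 0 would mean at most Δ positive degrees, fewer than the closed neighbourhood of a
  -- vertex of degree Δ supplies.
  ... | ℕ.zero , _ , few , _ with v , dv≡Δ ← maxDegree-attained 1≤Δ =
    contradiction few (<⇒≱ (begin-strict
      maxDegree G                                  ≡⟨ dv≡Δ ⟨
      degree G v                                   <⟨ degree<#nonisolated v (subst (1 ≤_) (sym dv≡Δ) 1≤Δ) ⟩
      sum (map (λ w → 1 ⊓ degree G w) (allFin n))  ≡⟨ cong sum (map-∘ {g = 1 ⊓_} (allFin n)) ⟩
      sum (map (1 ⊓_) (degrees G))                 ≡⟨ sum-↭ (Perm.map⁺ (1 ⊓_) ds↭) ⟨
      sum (map (1 ⊓_) ds)                          ∎))
    where open ≤-Reasoning
  ... | suc σ , le , _ , _ = begin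
    conflicts w + Δ                                ≤⟨ +-monoˡ-≤ Δ (conflicts-≤-excess w σ) ⟩
    degree G w * σ + excess (suc σ) + Δ            ≤⟨ +-monoˡ-≤ Δ (+-monoˡ-≤ _ (*-monoˡ-≤ σ (degree-≤ w))) ⟩
    Δ * σ + excess (suc σ) + Δ                     ≡⟨ cong (_+ Δ) (+-comm (Δ * σ) _) ⟩
    excess (suc σ) + Δ * σ + Δ                     ≡⟨ +-assoc (excess (suc σ)) _ Δ ⟩
    -- The Δ subtracted in s, moved to the left side, is what raises Δσ to Δ times the threshold.
    excess (suc σ) + (Δ * σ + Δ)                   ≡⟨ cong (excess (suc σ) +_) (trans (+-comm _ Δ) (sym (*-suc Δ σ))) ⟩
    excess (suc σ) + Δ * suc σ                     ≡⟨ cong (_+ Δ * suc σ) (trans (cong sum (map-∘ {g = _∸ suc σ} (allFin n)))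
                                                                                 (sym (sum-↭ (Perm.map⁺ (_∸ suc σ) ds↭)))) ⟩
    sum (map (_∸ suc σ) ds) + Δ * suc σ            ≤⟨ le ⟩
    sum (List.take Δ ds)                           ∎
    where
      open ≤-Reasoning
      Δ = maxDegree G

  degreeSequence-≤ : ∀ {ds} → IsDegreeSequence G ds →
                     sum (List.take (maxDegree G) ds) ≤ maxDegree G * maxDegree G
  degreeSequence-≤ {ds} (_ , ds↭) = begin
    sum (List.take Δ ds)            ≤⟨ sum≤length*bound (take⁺ Δ (All-resp-↭ (↭-sym ds↭) (xs≤max 0 (degrees G)))) ⟩
    length (List.take Δ ds) * Δ     ≡⟨ cong (_* Δ) (length-take Δ ds) ⟩
    (Δ ⊓ length ds) * Δ             ≤⟨ *-monoˡ-≤ Δ (m⊓n≤m Δ _) ⟩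
    Δ * Δ                           ∎
    where
      open ≤-Reasoning
      Δ = maxDegree G

  -- Conflicts against the number of edges

  edge? : Decidable (λ ((u , v) : Fin n × Fin n) → u Fin.< v × Adj u v)
  edge? (u , v) = (u Finₚ.<? v) ×-dec adj? u v

  ∈-edges : ∀ {u v} → u Fin.< v → Adj u v → (u , v) ∈ edges G
  ∈-edges u<v uv = ∈-filter⁺ edge? (∈-cartesianProduct⁺ (∈-allFin _) (∈-allFin _)) (u<v , uv)

  -- Orienting an edge away from w recovers the pairs in crossing w from the
  -- edges, where each edge occurs in one orientation only.
  conflicts<edgeCount : ∀ {a b} w → Adj a b → conflicts w < edgeCount G
  conflicts<edgeCount w ab = by-cases (crossing w) refl
    where
      orient : Fin n × Fin n → Fin n × Fin n
      orient (u , v) = if does (adj? w u) then (u , v) else (v , u)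
      oriented : ∀ {u v} → Adj w u → ¬ Adj w v → Adj u v → (u , v) ∈ map orient (edges G)
      oriented {u} {v} wu ¬wv uv with Finₚ.<-cmp u v
      ... | tri< u<v _ _  = subst (_∈ map orient (edges G)) keep (∈-map⁺ orient (∈-edges u<v uv))
        where
          keep : orient (u , v) ≡ (u , v)
          keep rewrite dec-true (adj? w u) wu = refl
      ... | tri≈ _ refl _ = contradiction uv (irrefl refl)
      ... | tri> _ _ v<u  = subst (_∈ map orient (edges G)) flip (∈-map⁺ orient (∈-edges v<u (Adj-sym uv)))
        where
          flip : orient (v , u) ≡ (u , v)
          flip rewrite dec-false (adj? w v) ¬wv = refl
      some-edge : ∀ {a b} → Adj a b → 1 ≤ edgeCount G
      some-edge {a} {b} ab with Finₚ.<-cmp a b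
      ... | tri< a<b _ _  = ∈-length (∈-edges a<b ab)
      ... | tri≈ _ refl _ = contradiction ab (irrefl refl)
      ... | tri> _ _ b<a  = ∈-length (∈-edges b<a (Adj-sym ab))
      by-cases : ∀ xs → crossing w ≡ xs → conflicts w < edgeCount G
      -- With no conflict at `w`, all that is required is one edge anywhere in the graph.
      by-cases []            eq rewrite eq = some-edge ab
      by-cases ((u , v) ∷ _) eq =
        subst (conflicts w <_) (length-map orient (edges G))
          -- Strictness comes from the edge between `u` and `w`: conflicting edges never contain
          -- `w`, so it is one edge more.
          (length-⊆ {xs = (u , w) ∷ crossing w} (All.tabulate uw≢ ∷ crossing-unique) ⊆edges)
        where
          wu : Adj w u
          wu = proj₁ (∈-crossing⁻ {w} (subst ((u , v) ∈_) (sym eq) (here refl)))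
          uw≢ : ∀ {e} → e ∈ crossing w → (u , w) ≢ e
          uw≢ e∈ refl = proj₂ (proj₂ (∈-crossing⁻ {w} e∈)) self∈N[]
          ⊆edges : ∀ {e} → e ∈ (u , w) ∷ crossing w → e ∈ map orient (edges G)
          ⊆edges (here refl) = oriented wu (irrefl refl) (Adj-sym wu)
          ⊆edges (there e∈) with wx , xy , y∉ ← ∈-crossing⁻ {w} e∈ = oriented wx (y∉ ∘ adj∈N[]) xy

  -- Conflicts against the number of vertices

  degree+codegree<n : ∀ w → degree G w + ∣ ∁ (N[ G ] w) ∣ < n
  degree+codegree<n w = begin-strict
    degree G w + ∣ ∁ (N[ G ] w) ∣   <⟨ +-monoˡ-< _ (degree<∣N[]∣ w) ⟩
    ∣ N[ G ] w ∣ + ∣ ∁ (N[ G ] w) ∣ ≡⟨ cong (∣ N[ G ] w ∣ +_) (∣∁p∣≡n∸∣p∣ (N[ G ] w)) ⟩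
    ∣ N[ G ] w ∣ + (n ∸ ∣ N[ G ] w ∣) ≡⟨ m+[n∸m]≡n (∣p∣≤n (N[ G ] w)) ⟩
    n                               ∎
    where open ≤-Reasoning

  -- A conflicting edge joins N(w) to the complement of N[w], two sets with at most `m` elements
  -- together, so the product of their sizes bounds the conflicts. The factor 4 clears the
  -- denominator of the square of m/2.
  conflicts-≤-square : ∀ {m} → n ≡ suc m → ∀ w → 4 * conflicts w ≤ m * m
  conflicts-≤-square {m} n≡ w = begin
    4 * conflicts w ≤⟨ *-monoʳ-≤ 4 (subst (λ z → z + conflicts w ≤ a * b) (*-zeroʳ a) (conflicts-≤-uniform w 0 b (λ {u} _ → ∣p∩q∣≤∣q∣ (N⟨ G ⟩ u) _))) ⟩
    4 * (a * b)     ≤⟨ 4ab≤[a+b]² a b ⟩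
    (a + b) * (a + b) ≤⟨ *-mono-≤ a+b≤m a+b≤m ⟩
    m * m           ∎
    where
      open ≤-Reasoning
      a = degree G w
      b = ∣ ∁ (N[ G ] w) ∣
      a+b≤m : a + b ≤ m
      a+b≤m = s≤s⁻¹ (subst (a + b <_) n≡ (degree+codegree<n w))

  -- Strong induction: if no least choosable number at most `k` existed, the recursive call would
  -- refute choosability for every smaller `j`, and `k` itself would be the least.
  least-choosable : ∀ {k} → 1 ≤ k → ClosedDistinguishingChoosable G k → ¬ ¬ (∃[ d ] (IsDisℓ G d × d ≤ k))
  least-choosable {k} = <-rec
    (λ k → 1 ≤ k → ClosedDistinguishingChoosable G k → ¬ ¬ (∃[ d ] (IsDisℓ G d × d ≤ k)))
    (λ k rec 1≤k ch none → none (k , (1≤k , ch , λ j 1≤j chj → ≮⇒≥ λ j<k →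
      rec j<k 1≤j chj λ (d , isd , d≤j) → none (d , isd , ≤-trans d≤j (<⇒≤ j<k))) , ≤-refl)) k

open import Data.Integer using (+_; _+_; _-_; _*_; _⊓_; _≤_)
open import Data.List using (take)
open import Data.Rational.Unnormalised as ℚᵘ using (1ℚᵘ; _/_)
import Data.Integer as ℤ
import Data.Integer.Properties as ℤₚ
import Data.Nat.Properties as ℕₚ
import Data.Rational.Unnormalised.Properties as ℚᵘₚ
open import Data.Integer.Tactic.RingSolver using (solve-∀)

-- From conflict counts to integer and rational bounds

fromℤ-mono : ∀ {i j} → i ≤ j → fromℤ i ℚᵘ.≤ fromℤ j
fromℤ-mono i≤j = ℚᵘ.*≤* (ℤₚ.*-monoʳ-≤-nonNeg (+ 1) i≤j)

-- Counts are proved in ℕ while the bounds contain true subtractions; `k` is the amount whose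
-- addition turns `E` back into a natural number.
≤-from-shift : ∀ {x k y E} → E + + k ≡ + y → x ℕ.+ k ℕ.≤ y → + x ≤ E
≤-from-shift {x} {k} {y} {E} eq le = begin
  + x                 ≡⟨ add-sub (+ x) (+ k) ⟨
  + x + + k - + k     ≤⟨ ℤₚ.+-monoˡ-≤ (ℤ.- + k) (ℤ.+≤+ le) ⟩
  + y - + k           ≡⟨ cong (_- + k) eq ⟨
  E + + k - + k       ≡⟨ add-sub E (+ k) ⟩
  E                   ∎
  where
    open ℤₚ.≤-Reasoning
    add-sub : ∀ i j → i + j - j ≡ i
    add-sub = solve-∀

module _ {n : ℕ} (G : Graph n) where

  choosable⇒disℓ≤ : ∀ {B k} → 1 ℕ.≤ k → ClosedDistinguishingChoosable G k → fromℤ (+ k) ℚᵘ.≤ B → disℓ[ G ]≤ B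
  choosable⇒disℓ≤ {B} {k} 1≤k ch k≤B =
    (λ none → least-choosable G 1≤k ch λ (d , isd , d≤k) →
      none (d , isd , ℚᵘₚ.≤-trans {fromℤ (+ d)} {fromℤ (+ k)} {B} (fromℤ-mono (ℤ.+≤+ d≤k)) k≤B)) ,
    (k , 1≤k , k≤B , ch)

  -- `B` may be fractional, so the list length is read off the graph instead: one more than the
  -- largest number of conflicts, attained at the `argmax`.
  conflicts⇒disℓ≤ : ∀ {B} → Fin n → (∀ w → fromℤ (+ ℕ.suc (conflicts G w)) ℚᵘ.≤ B) → disℓ[ G ]≤ B
  conflicts⇒disℓ≤ {B} v₀ le =
    choosable⇒disℓ≤ {B = B} (ℕ.s≤s ℕ.z≤n)
      (choosable G v₀ (ℕ.s≤s ℕ.z≤n) λ w _ → ℕ.s≤s (All.lookup (f[xs]≤f[argmax] v₀ (allFin n)) (∈-allFin w)))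
      (le (argmax (conflicts G) v₀ (allFin n)))
    where open import Data.List.Extrema.Nat using (argmax; f[xs]≤f[argmax])

  conflicts⇒disℓ≤ᶻ : ∀ i → Fin n → (∀ w → + ℕ.suc (conflicts G w) ≤ i) → disℓ[ G ]≤ fromℤ i
  conflicts⇒disℓ≤ᶻ i v₀ le = conflicts⇒disℓ≤ {B = fromℤ i} v₀ (λ w → fromℤ-mono (le w))

disℓ≤square : ∀ {n} (G : Graph n) → Fin n → let h = (+ n - + 1) / 2 in disℓ[ G ]≤ (h ℚᵘ.* h ℚᵘ.+ 1ℚᵘ)
disℓ≤square {ℕ.zero}  _ ()
disℓ≤square {ℕ.suc m} G v₀ = conflicts⇒disℓ≤ G {B = h ℚᵘ.* h ℚᵘ.+ 1ℚᵘ} v₀ λ w → ℚᵘ.*≤* (begin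
    + ℕ.suc (conflicts G w) * + 4              ≡⟨ ℤₚ.pos-* (ℕ.suc (conflicts G w)) 4 ⟨
    + (ℕ.suc (conflicts G w) ℕ.* 4)            ≤⟨ ℤ.+≤+ (le w) ⟩
    + (m ℕ.* m ℕ.+ 4)                          ≡⟨ cong (_+ + 4) (ℤₚ.pos-* m m) ⟩
    + m * + m + + 4                            ≡⟨ expand (+ m) ⟩
    (+ m * + m * + 1 + + 4) * + 1              ∎)
  where
    open ℤₚ.≤-Reasoning
    h = (+ ℕ.suc m - + 1) / 2
    expand : ∀ i → i * i + + 4 ≡ (i * i * + 1 + + 4) * + 1
    expand = solve-∀
    le : ∀ w → ℕ.suc (conflicts G w) ℕ.* 4 ℕ.≤ m ℕ.* m ℕ.+ 4
    le w = subst₂ ℕ._≤_ (ℕₚ.*-comm 4 (ℕ.suc (conflicts G w))) (ℕₚ.+-comm 4 _)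
      (subst (ℕ._≤ 4 ℕ.+ m ℕ.* m) (sym (ℕₚ.*-suc 4 (conflicts G w))) (ℕₚ.+-monoʳ-≤ 4 (conflicts-≤-square G refl w)))

theorem5 :
  ∀ {n : ℕ} (G : Graph n) (ds : List ℕ) →
  IsDegreeSequence G ds →
  2 ℕ.≤ maxDegree G →
  let Δ = + maxDegree G
      s = + sum (take (maxDegree G) ds) - Δ
      m = + edgeCount G
  in
    -- (i)
    ((disℓ[ G ]≤ fromℤ (s + + 1)) × s + + 1 ≤ Δ * Δ - Δ + + 1)
    -- (ii)
  × (disℓ[ G ]≤ fromℤ m)
    -- (iii)
  × (∀ (t : ℕ) → #ofDegree G (maxDegree G) ≡ t →
      disℓ[ G ]≤ fromℤ ((Δ * Δ - + 2 * Δ + + t + + 1) ⊓ (Δ * Δ - Δ + + 1)))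
    -- (iv)
  × (∃! _≡_ (λ v → degree G v ≡ maxDegree G) →
      disℓ[ G ]≤ fromℤ (Δ * Δ - + 3 * Δ + + 4))
    -- (v)
  × (∀ (k lam mu : ℕ) → StronglyRegular G k lam mu →
      disℓ[ G ]≤ fromℤ (+ k * (+ k - + lam - + 1) + + 1))
    -- (vi)
  × (let h = (+ n - + 1) / 2 in disℓ[ G ]≤ (h ℚᵘ.* h ℚᵘ.+ 1ℚᵘ))
theorem5 {n} G ds isDS 2≤Δ = (i , s+1≤) , ii , iii , iv , v , disℓ≤square G v₀
  where
    open import Data.Nat.Tactic.RingSolver renaming (solve-∀ to solveℕ-∀)
    d = maxDegree G
    Δ = + d
    S = sum (take d ds)
    c = conflicts G

    1≤Δ : 1 ℕ.≤ d
    1≤Δ = ℕₚ.<⇒≤ 2≤Δ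

    v₀ : Fin n
    v₀ = proj₁ (maxDegree-attained G 1≤Δ)

    ∃e : ∃[ e ] 2 ℕ.+ e ≡ d
    ∃e = ℕₚ.m≤n⇒∃[o]m+o≡n 2≤Δ

    e = proj₁ ∃e

    2+e≡d : 2 ℕ.+ e ≡ d
    2+e≡d = proj₂ ∃e

    c<s+1 : ∀ w → + ℕ.suc (c w) ≤ + S - Δ + + 1
    c<s+1 w = ≤-from-shift (shift-eq (+ S) Δ)
      (subst (ℕ.suc (c w) ℕ.+ d ℕ.≤_) (ℕₚ.+-comm 1 S) (ℕ.s≤s (conflicts-≤-degreeSequence G isDS 1≤Δ w)))
      where
        shift-eq : ∀ s δ → s - δ + + 1 + δ ≡ s + + 1
        shift-eq = solve-∀

    s+1≤ : + S - Δ + + 1 ≤ Δ * Δ - Δ + + 1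
    s+1≤ = ℤₚ.+-monoˡ-≤ (+ 1) (ℤₚ.+-monoˡ-≤ (ℤ.- Δ)
      (subst (+ S ≤_) (ℤₚ.pos-* d d) (ℤ.+≤+ (degreeSequence-≤ G isDS))))

    i : disℓ[ G ]≤ fromℤ (+ S - Δ + + 1)
    i = conflicts⇒disℓ≤ᶻ G (+ S - Δ + + 1) v₀ c<s+1

    ii : disℓ[ G ]≤ fromℤ (+ edgeCount G)
    ii = conflicts⇒disℓ≤ᶻ G (+ edgeCount G) v₀ λ w → ℤ.+≤+ (conflicts<edgeCount G w (proj₂ (neighbour G v₀
      (subst (1 ℕ.≤_) (sym (proj₂ (maxDegree-attained G 1≤Δ))) 1≤Δ))))

    iii : ∀ t → #ofDegree G d ≡ t → disℓ[ G ]≤ fromℤ ((Δ * Δ - + 2 * Δ + + t + + 1) ⊓ (Δ * Δ - Δ + + 1))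
    iii t refl = conflicts⇒disℓ≤ᶻ G ((Δ * Δ - + 2 * Δ + + t + + 1) ⊓ (Δ * Δ - Δ + + 1)) v₀
      λ w → ℤₚ.⊓-glb (c≤ w) (ℤₚ.≤-trans (c<s+1 w) s+1≤)
      where
        shift-eq : ∀ δ τ → δ * δ - + 2 * δ + τ + + 1 + + 2 * δ ≡ δ * δ + τ + + 1
        shift-eq = solve-∀
        expand : ∀ e t → ℕ.suc ((2 ℕ.+ e) ℕ.* e ℕ.+ t) ℕ.+ 2 ℕ.* (2 ℕ.+ e) ≡ (2 ℕ.+ e) ℕ.* (2 ℕ.+ e) ℕ.+ t ℕ.+ 1
        expand = solveℕ-∀
        c≤ : ∀ w → + ℕ.suc (c w) ≤ Δ * Δ - + 2 * Δ + + t + + 1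
        c≤ w = ≤-from-shift {k = 2 ℕ.* d}
          (trans (cong (_+_ (Δ * Δ - + 2 * Δ + + t + + 1)) (ℤₚ.pos-* 2 d))
            (trans (shift-eq Δ (+ t)) (cong (λ z → z + + t + + 1) (sym (ℤₚ.pos-* d d))))) (begin
          ℕ.suc (c w) ℕ.+ 2 ℕ.* d
            ≤⟨ ℕₚ.+-monoˡ-≤ (2 ℕ.* d) (ℕ.s≤s (conflicts-≤-maxDegree G w (sym 2+e≡d))) ⟩
          ℕ.suc (degree G w ℕ.* e ℕ.+ t) ℕ.+ 2 ℕ.* d
            ≤⟨ ℕₚ.+-monoˡ-≤ (2 ℕ.* d) (ℕ.s≤s (ℕₚ.+-monoˡ-≤ t (ℕₚ.*-monoˡ-≤ e (degree-≤ G w)))) ⟩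
          ℕ.suc (d ℕ.* e ℕ.+ t) ℕ.+ 2 ℕ.* d
            ≡⟨ subst (λ d → ℕ.suc (d ℕ.* e ℕ.+ t) ℕ.+ 2 ℕ.* d ≡ d ℕ.* d ℕ.+ t ℕ.+ 1) 2+e≡d (expand e t) ⟩
          d ℕ.* d ℕ.+ t ℕ.+ 1 ∎)
          where open ℕₚ.≤-Reasoning

    iv : ∃! _≡_ (λ v → degree G v ≡ d) → disℓ[ G ]≤ fromℤ (Δ * Δ - + 3 * Δ + + 4)
    -- With Δ = 2 + e, a vertex other than `x` has degree at most 1 + e and hence at most (1 + e)e +
    -- 1 conflicts, the last 1 being the excess of `x`. Lists one longer have (Δ - 1)(Δ - 2) + 2 =
    -- Δ² - 3Δ + 4 elements.
    iv (x , _ , only) = choosable⇒disℓ≤ G {B = fromℤ (Δ * Δ - + 3 * Δ + + 4)} (ℕ.s≤s ℕ.z≤n)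
      (choosable G x (ℕ.s≤s ℕ.z≤n) c≤)
      (fromℤ-mono (≤-from-shift {k = 3 ℕ.* d}
        (trans (cong (_+_ (Δ * Δ - + 3 * Δ + + 4)) (ℤₚ.pos-* 3 d))
          (trans (shift-eq Δ) (cong (_+ + 4) (sym (ℤₚ.pos-* d d)))))
        (ℕₚ.≤-reflexive (subst (λ d → ℕ.suc (ℕ.suc e ℕ.* e ℕ.+ 1) ℕ.+ 3 ℕ.* d ≡ d ℕ.* d ℕ.+ 4) 2+e≡d (expand e)))))
      where
        shift-eq : ∀ δ → δ * δ - + 3 * δ + + 4 + + 3 * δ ≡ δ * δ + + 4
        shift-eq = solve-∀
        expand : ∀ e → ℕ.suc (ℕ.suc e ℕ.* e ℕ.+ 1) ℕ.+ 3 ℕ.* (2 ℕ.+ e) ≡ (2 ℕ.+ e) ℕ.* (2 ℕ.+ e) ℕ.+ 4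
        expand = solveℕ-∀
        degree≤1+e : ∀ {w} → w ≢ x → degree G w ℕ.≤ ℕ.suc e
        degree≤1+e {w} w≢x = ℕ.s≤s⁻¹ (subst (degree G w ℕ.<_) (sym 2+e≡d)
          (ℕₚ.≤∧≢⇒< (degree-≤ G w) (λ dw≡d → w≢x (sym (only dw≡d)))))
        c≤ : ∀ w → w ≢ x → c w ℕ.< ℕ.suc (ℕ.suc e ℕ.* e ℕ.+ 1)
        c≤ w w≢x = ℕ.s≤s (ℕₚ.≤-trans (conflicts-≤-maxDegree G w (sym 2+e≡d))
          (ℕₚ.+-mono-≤ (ℕₚ.*-monoˡ-≤ e (degree≤1+e w≢x)) (#ofDegree-unique G x only)))

    v : ∀ k lam mu → StronglyRegular G k lam mu → disℓ[ G ]≤ fromℤ (+ k * (+ k - + lam - + 1) + + 1)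
    v k lam mu (regular , adjacent , _) = conflicts⇒disℓ≤ᶻ G (+ k * (+ k - + lam - + 1) + + 1) v₀ λ w →
      -- The shift k(λ + 1) is what the `k` neighbours of `w` lose from their total degree k²: each
      -- loses `w` and its λ common neighbours with `w`.
      ≤-from-shift {k = k ℕ.* ℕ.suc lam}
        (trans (cong (_+_ (+ k * (+ k - + lam - + 1) + + 1)) (ℤₚ.pos-* k (ℕ.suc lam)))
          (trans (shift-eq (+ k) (+ lam)) (cong (_+_ (+ 1)) (sym (ℤₚ.pos-* k k)))))
        (ℕ.s≤s (subst (ℕ._≤ k ℕ.* k) (ℕₚ.+-comm (k ℕ.* ℕ.suc lam) (c w)) (c≤ w)))
      where
        shift-eq : ∀ κ μ → κ * (κ - μ - + 1) + + 1 + κ * (+ 1 + μ) ≡ + 1 + κ * κ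
        shift-eq = solve-∀
        c≤ : ∀ w → k ℕ.* ℕ.suc lam ℕ.+ c w ℕ.≤ k ℕ.* k
        c≤ w = subst (λ δ → δ ℕ.* ℕ.suc lam ℕ.+ c w ℕ.≤ δ ℕ.* k) (regular w)
          (conflicts-≤-uniform G w (ℕ.suc lam) k λ {u} wu →
            subst₂ (λ l δ → ℕ.suc (l ℕ.+ ∣ outside G w u ∣) ℕ.≤ δ) (adjacent w u wu) (regular u)
              (outside+common<degree G wu))
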